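{- Let $X$ be a finite set of cardinality $n$, let $N=\binom{n}{2}$, and let $\ast\in\mathcal{M}(X)$ be a binary operation with $crank(T_\ast)=c$ and $arank(T_\ast)=a$. Then the cardinality of the $\mathcal{R}$-class of $\ast$ in $\mathcal{M}(X)$ is precisely $$2^a\,\frac{n!}{(n-c)!}\,\frac{N!}{(N-a)!}.$$
   Context: $\mathcal{M}(X)=X^{X\times X}$ is the set of all binary operations on $X$, a monoid under $\triangleright$ defined by $a(\circ\triangleright\ast)b=(a\circ b)\ast(b\circ a)$ for all $a,b\in X$, with identity $a\circ_{lz}b=a$. The right Green's relation $\mathcal{R}$: $\ast\,\mathcal{R}\,\star$ iff $\{\ast\triangleright\circ:\circ\in\mathcal{M}(X)\}=\{\star\triangleright\circ:\circ\in\mathcal{M}(X)\}$. The pairmorph transformation of $\ast$ is $T_\ast:X\times X\to X\times X$, $T_\ast(a,b)=(a\ast b,b\ast a)$. Let $\Delta(X)=\{(x,x):x\in X\}$ and $im(T_\ast)=T_\ast(X\times X)$. Fix a tournament $\omega$ on $X$, i.e. a set $\omega\subseteq X\times X\setminus\Delta(X)$ containing exactly one of $(a,b),(b,a)$ for every pair of distinct $a,b\in X$. Let $acdom(T_\ast)=\{(a,b)\in X\times X:T_\ast(a,b)\notin\Delta(X)\}$, and let $accok_\ast:acdom(T_\ast)\cap\omega\to\omega$ be given by $accok_\ast(a,b)=T_\ast(a,b)$ if $T_\ast(a,b)\in\omega$, and $accok_\ast(a,b)=T_\ast(b,a)$ otherwise. Define $crank(T_\ast)=|im(T_\ast)\cap\Delta(X)|$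 and $arank(T_\ast)=|im(accok_\ast)|$. -}

module Defs where

open import Algebra.Bundles using (Monoid)
open import Algebra.Core using (Op₂)
open import Data.Fin.Base using (Fin)
open import Data.Nat.Base using (ℕ)
open import Data.Product.Base using (Σ; ∃; _×_; _,_; proj₁; proj₂)
open import Data.Sum.Base using (_⊎_; inj₁; inj₂)
open import Function.Base using (_∘_)
open import Function.Bundles using (Inverse)
open import Level using (Level; _⊔_; suc)
open import Relation.Binary.Bundles using (Setoid)
import Relation.Binary.Construct.On as On
open import Relation.Binary.Core using (Rel)
open import Relation.Binary.PropositionalEquality
  using (_≡_; _≢_; refl; sym; trans; cong₂; setoid)
open import Relation.Unary using (Pred; _∈_; _∉_; _∩_; _⊆_; ∁; _≐_)

private
  variable
    a b p r ℓ : Level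

------------------------------------------------------------------------
-- Subsets, images and cardinality

-- Elements of a subset are compared in the ambient setoid, so that neither
-- membership proofs nor representatives are counted separately.
subset : (S : Setoid a ℓ) → Pred (Setoid.Carrier S) p → Setoid (a ⊔ p) ℓ
subset S P = On.setoid {B = Σ (Setoid.Carrier S) P} S proj₁

HasCardinality : Setoid a ℓ → ℕ → Set (a ⊔ ℓ)
HasCardinality S m = Inverse S (setoid (Fin m))

im : {A : Set a} {B : Set b} → (A → B) → Pred B (a ⊔ b)
im f y = ∃ λ x → f x ≡ y

------------------------------------------------------------------------
-- Green's right relation of a monoid

module Green (M : Monoid a ℓ) where
  open Monoid M renaming (setoid to carrierSetoid)

  rightIdeal : Carrier → Pred Carrier (a ⊔ ℓ)
  rightIdeal x y = ∃ λ s → y ≈ x ∙ s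

  _𝓡_ : Rel Carrier (a ⊔ ℓ)
  x 𝓡 y = rightIdeal x ≐ rightIdeal y

  𝓡-class : Carrier → Setoid (a ⊔ ℓ) ℓ
  𝓡-class x = subset carrierSetoid (x 𝓡_)

------------------------------------------------------------------------
-- The monoid of binary operations on X

module _ {X : Set a} where

  infixl 7 _▷_

  _▷_ : Op₂ X → Op₂ X → Op₂ X
  (_∘₁_ ▷ _∘₂_) x y = (x ∘₁ y) ∘₂ (y ∘₁ x)

  lz : Op₂ X
  lz x y = x

-- Without function extensionality, equality of operations is pointwise.
𝓜 : Set a → Monoid a a
𝓜 X = record
  { Carrier  = Op₂ X
  ; _≈_      = λ f g → ∀ x y → f x y ≡ g x y
  ; _∙_      = _▷_
  ; ε        = lz
  ; isMonoid = record
    { isSemigroup = record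
      { isMagma = record
        { isEquivalence = record
          { refl  = λ _ _ → refl
          ; sym   = λ f≈g x y → sym (f≈g x y)
          ; trans = λ f≈g g≈h x y → trans (f≈g x y) (g≈h x y)
          }
        ; ∙-cong = λ {f} {f′} {g} {g′} f≈f′ g≈g′ x y →
            trans (cong₂ g (f≈f′ x y) (f≈f′ y x)) (g≈g′ (f′ x y) (f′ y x))
        }
      ; assoc = λ _ _ _ _ _ → refl
      }
    ; identity = (λ _ _ _ → refl) , (λ _ _ _ → refl)
    }
  }

------------------------------------------------------------------------
-- Pairmorphs, crank and arank

module _ {X : Set a} where

  pairmorph : Op₂ X → X × X → X × X
  pairmorph _∗_ (x , y) = x ∗ y , y ∗ x

  Δ : Pred (X × X) a
  Δ (x , y) = x ≡ y

  HasCrank : Op₂ X → ℕ → Set a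
  HasCrank ∗ = HasCardinality (subset (setoid (X × X)) (im (pairmorph ∗) ∩ Δ))

  acdom : Op₂ X → Pred (X × X) a
  acdom ∗ q = pairmorph ∗ q ∉ Δ

record Tournament (X : Set a) r : Set (a ⊔ suc r) where
  field
    ω          : Pred (X × X) r
    ω⊆∁Δ       : ω ⊆ ∁ Δ
    exactlyOne : ∀ {x y} → x ≢ y →
                 ((x , y) ∈ ω × (y , x) ∉ ω) ⊎ ((x , y) ∉ ω × (y , x) ∈ ω)

module _ {X : Set a} (t : Tournament X r) where
  open Tournament t

  accok : (∗ : Op₂ X) → Σ (X × X) (acdom ∗ ∩ ω) → Σ (X × X) ω
  accok ∗ ((x , y) , Txy∉Δ , _) with exactlyOne Txy∉Δ
  ... | inj₁ (Txy∈ω , _) = pairmorph ∗ (x , y) , Txy∈ω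
  ... | inj₂ (_ , Tyx∈ω) = pairmorph ∗ (y , x) , Tyx∈ω

  HasArank : Op₂ X → ℕ → Set (a ⊔ r)
  HasArank ∗ =
    HasCardinality (subset (setoid (X × X)) (im (proj₁ ∘ accok ∗)))

{-# OPTIONS --safe #-}

-- Sending ∗ to T_∗ identifies 𝓜(X) with the monoid of self-maps of X × X that
-- commute with the swap, and ∗ 𝓡 ⋆ holds iff T_⋆ = S ∘ T_∗ for a
-- swap-equivariant injection S of im(T_∗) into X × X.  As a set with
-- involution, im(T_∗) consists of c fixed points and a free orbits, and X × X
-- of n fixed points and N free orbits.  An equivariant injection is therefore
-- an injection on the fixed points, an injection on the free orbits, and a
-- choice of one of two orientations for each of the a free orbits.
module Submission where

open import Defs
open import Algebra.Bundles using (Monoid)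
open import Algebra.Core using (Op₂)
open import Data.Bool.Base using (Bool; true; false; not; _xor_)
open import Data.Bool.Properties
  using (not-¬; not-distribˡ-xor; xor-assoc; xor-same; xor-identityʳ)
open import Data.Fin.Base
  using (Fin; zero; suc; _↑ˡ_; _↑ʳ_; splitAt; combine;
         punchIn; punchOut; funToFin; finToFun)
open import Data.Fin.Properties as Fin
  using (splitAt-↑ˡ; splitAt-↑ʳ; splitAt⁻¹-↑ˡ; splitAt⁻¹-↑ʳ; *↔×; 2↔Bool; any?;
         suc-injective; 0≢1+n; punchIn-injective; punchInᵢ≢i; punchIn-punchOut;
         punchOut-punchIn; punchOut-cong; punchOut-injective;
         finToFun-funToFin; funToFin-finToFin; injective⇒≤)
open import Data.Nat.Base using (ℕ; zero; suc; _+_; _*_; _∸_; _^_; _/_; _!)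
open import Data.Nat.Combinatorics using (_C_; nC1≡n; nCk+nC[k+1]≡[n+1]C[k+1])
open import Data.Nat.Combinatorics.Base using (_P′_)
open import Data.Nat.Combinatorics.Specification using (nP′k≡n!/[n∸k]!; nP′k≡n[n∸1P′k∸1])
open import Data.Nat.Properties using (_!≢0; 0∸n≡0)
open import Data.Product.Base using (Σ; ∃; _×_; _,_; proj₁; proj₂; swap; map; map₁)
open import Data.Product.Function.NonDependent.Setoid using (_×-inverse_)
open import Data.Product.Properties using (≡-dec; ,-injectiveˡ; ,-injectiveʳ)
open import Data.Product.Relation.Binary.Pointwise.NonDependent using (_×ₛ_; Pointwise-≡↔≡)
open import Data.Sum.Base as Sum using (_⊎_; inj₁; inj₂)
open import Data.Sum.Properties using (inj₁-injective; inj₂-injective)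
open import Function.Base using (_∘_; case_of_)
open import Function.Bundles using (Inverse; _↔_; mk↔ₛ′)
open import Function.Construct.Composition using () renaming (inverse to compose)
open import Function.Construct.Identity using () renaming (inverse to idInverse)
open import Function.Construct.Symmetry using () renaming (inverse to symInverse)
open import Function.Definitions using (Injective)
open import Function.Properties.Inverse using (Inverse⇒Injection)
open import Level using (Level)
open import Relation.Binary.Bundles using (Setoid)
open import Relation.Binary.Definitions using (DecidableEquality)
open import Relation.Binary.PropositionalEquality
  using (_≡_; _≢_; refl; sym; trans; cong; cong₂; subst; subst₂; setoid; _→-setoid_;
         module ≡-Reasoning)
open import Relation.Nullary using (Dec; yes; no; ¬_; contradiction)
open import Relation.Nullary.Decidable using (map′; _⊎-dec_; via-injection)
open import Relation.Unary using (Pred; Decidable; _∈_; _⊆_)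

private
  variable
    ℓ ℓ₁ ℓ₂ r : Level
    c a n m k N : ℕ

-- Inverses of setoids, products and sign vectors.

mkInverse : (S : Setoid ℓ ℓ₁) (T : Setoid r ℓ₂) →
  let module S = Setoid S; module T = Setoid T in
  (to : S.Carrier → T.Carrier) (from : T.Carrier → S.Carrier) →
  (∀ {x y} → x S.≈ y → to x T.≈ to y) →
  (∀ {x y} → x T.≈ y → from x S.≈ from y) →
  (∀ y → to (from y) T.≈ y) → (∀ x → from (to x) S.≈ x) → Inverse S T
mkInverse S T to from to-cong from-cong to∘from from∘to = record
  { to = to ; from = from ; to-cong = to-cong ; from-cong = from-cong
  ; inverse = (λ eq → Setoid.trans T (to-cong eq) (to∘from _))
            , (λ eq → Setoid.trans S (from-cong eq) (from∘to _))
  }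

×-cardinality : {S : Setoid ℓ ℓ₁} {T : Setoid r ℓ₂} →
  HasCardinality S m → HasCardinality T k → HasCardinality (S ×ₛ T) (m * k)
×-cardinality S≃m T≃k =
  compose (compose (S≃m ×-inverse T≃k) Pointwise-≡↔≡) (symInverse *↔×)

-- A sign vector is the string of binary digits of a number below `2 ^ a`. Pointwise equality of
-- vectors stands in for function extensionality.
signs-cardinality : ∀ a → HasCardinality (Fin a →-setoid Bool) (2 ^ a)
signs-cardinality a = mkInverse (Fin a →-setoid Bool) (setoid (Fin (2 ^ a)))
  (λ s → funToFin (B.from ∘ s))
  (λ i → B.to ∘ finToFun {2} {a} i)
  (λ s≗s′ → funToFin-cong (cong B.from ∘ s≗s′))
  (λ { refl _ → refl })
  (λ i → trans (funToFin-cong {a} {2} (λ j → B.strictlyInverseʳ (finToFun {2} {a} i j)))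
               (funToFin-finToFin {a} {2} i))
  (λ s j → trans (cong B.to (finToFun-funToFin (B.from ∘ s) j)) (B.strictlyInverseˡ (s j)))
  where
  module B = Inverse 2↔Bool
  funToFin-cong : ∀ {a m} {f g : Fin a → Fin m} → (∀ i → f i ≡ g i) → funToFin f ≡ funToFin g
  funToFin-cong {zero}  f≗g = refl
  funToFin-cong {suc a} f≗g = cong₂ combine (f≗g zero) (funToFin-cong (f≗g ∘ suc))

-- Counting injections by falling factorials.

Injections : ℕ → ℕ → Setoid _ _
Injections m n = subset (Fin m →-setoid Fin n) (λ f → Injective _≡_ _≡_ f)

-- Once the value at `zero` is chosen, the other values avoid it, and `punchOut` renumbers them as
-- an injection into `Fin n`.
injections-suc : ∀ m n →
  Inverse (Injections (suc m) (suc n)) (setoid (Fin (suc n)) ×ₛ Injections m n)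
injections-suc m n = mkInverse _ (setoid _ ×ₛ Injections m n) to from
  (λ f≗g → f≗g zero , λ i → punchOut-cong₂ (f≗g zero) (f≗g (suc i)))
  (λ { (refl , f≗g) zero → refl ; {x , _} (refl , f≗g) (suc i) → cong (punchIn x) (f≗g i) })
  (λ { (x , f , f-inj) → refl , λ i → trans (punchOut-cong x refl) (punchOut-punchIn x) })
  (λ { (f , f-inj) zero → refl ; (f , f-inj) (suc i) → punchIn-punchOut _ })
  where
  punchOut-cong₂ : ∀ {n} {i i′ j j′ : Fin (suc n)} {i≢j : i ≢ j} {i′≢j′ : i′ ≢ j′} →
    i ≡ i′ → j ≡ j′ → punchOut i≢j ≡ punchOut i′≢j′
  punchOut-cong₂ {i = i} refl refl = punchOut-cong i refl

  to : Setoid.Carrier (Injections (suc m) (suc n)) →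
       Fin (suc n) × Setoid.Carrier (Injections m n)
  to (f , f-inj) = f zero , (λ i → punchOut {i = f zero} {f (suc i)} (0≢1+n ∘ f-inj)) ,
    λ {i} {j} eq → suc-injective (f-inj
      (punchOut-injective {i = f zero} {f (suc i)} {f (suc j)} _ _ eq))

  from : Fin (suc n) × Setoid.Carrier (Injections m n) →
         Setoid.Carrier (Injections (suc m) (suc n))
  from (x , f , f-inj) = g , g-inj
    where
    g : Fin (suc m) → Fin (suc n)
    g zero    = x
    g (suc i) = punchIn x (f i)
    g-inj : Injective _≡_ _≡_ g
    g-inj {zero}  {zero}  eq = refl
    g-inj {zero}  {suc j} eq = contradiction (sym eq) (punchInᵢ≢i x (f j))
    g-inj {suc i} {zero}  eq = contradiction eq (punchInᵢ≢i x (f i))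
    g-inj {suc i} {suc j} eq = cong suc (f-inj (punchIn-injective x _ _ eq))

injections-cardinality : ∀ m n → HasCardinality (Injections m n) (n P′ m)
injections-cardinality zero n = mkInverse _ (setoid (Fin 1))
  (λ _ → zero) (λ _ → (λ ()) , λ { {()} }) (λ _ → refl) (λ _ ())
  (λ { zero → refl }) (λ _ ())
-- The leading factor `0 ∸ m` of `0 P′ suc m` is 0, so the count to be established is 0.
injections-cardinality (suc m) zero rewrite 0∸n≡0 m = mkInverse _ (setoid (Fin 0))
  (λ (f , _) → f zero) (λ ()) (λ f≗g → f≗g zero) (λ { {()} })
  (λ ()) (λ (f , _) → case f zero of λ ())
injections-cardinality (suc m) (suc n) =
  -- `_P′_` computes by splitting off its last factor, whereas the choice of the value at `zero`
  -- accounts for the first, `suc n`.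
  subst (HasCardinality _) (sym (nP′k≡n[n∸1P′k∸1] (suc n) (suc m)))
    (compose (injections-suc m n)
      (×-cardinality (idInverse (setoid (Fin (suc n)))) (injections-cardinality m n)))

-- Equivariant injections between involutive sets.

-- The involutive set with m fixed points and k free orbits.
Orbits : ℕ → ℕ → Set
Orbits m k = Fin m ⊎ (Fin k × Bool)

ι : Orbits m k → Orbits m k
ι (inj₁ i)       = inj₁ i
ι (inj₂ (j , b)) = inj₂ (j , not b)

EquivariantInjections : ℕ → ℕ → ℕ → ℕ → Setoid _ _
EquivariantInjections c a n N = subset (Orbits c a →-setoid Orbits n N)
  (λ h → (∀ i → h (ι i) ≡ ι (h i)) × Injective _≡_ _≡_ h)

ι-fixed : (x : Orbits m k) → ι x ≡ x → ∃ λ i → x ≡ inj₁ i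
ι-fixed (inj₁ i)       _  = i , refl
ι-fixed (inj₂ (j , b)) eq = contradiction (sym (,-injectiveʳ (inj₂-injective eq))) (not-¬ refl)

ι-moved : (x : Orbits m k) → ι x ≢ x → ∃ λ y → x ≡ inj₂ y
ι-moved (inj₁ i) ιx≢x = contradiction refl ιx≢x
ι-moved (inj₂ y) _    = y , refl

-- Equivariance sends fixed points to fixed points, and injectivity keeps free points free. On a
-- free orbit the image of the point with sign `false` determines everything: its orbit gives the
-- injection on orbits, its sign the orientation.
equivariantInjections-split : ∀ c a n N →
  Inverse (EquivariantInjections c a n N)
          (((Fin a →-setoid Bool) ×ₛ Injections c n) ×ₛ Injections a N)
equivariantInjections-split c a n N =
  mkInverse S T to from
    (λ {h} {h′} eq → ((λ j → cong proj₂ (free-cong h h′ eq j)) , fixed-cong h h′ eq)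
                   , (λ j → cong proj₁ (free-cong h h′ eq j)))
    (λ { ((s≗ , f≗) , g≗) (inj₁ i) → cong inj₁ (f≗ i)
       ; ((s≗ , f≗) , g≗) (inj₂ (j , b)) →
           cong₂ (λ k s → inj₂ (k , b xor s)) (g≗ j) (s≗ j) })
    to∘from
    from∘to
  where
  S = EquivariantInjections c a n N
  T = ((Fin a →-setoid Bool) ×ₛ Injections c n) ×ₛ Injections a N

  module _ (H : Setoid.Carrier S) where
    private
      h     = proj₁ H
      h-ι   = proj₁ (proj₂ H)
      h-inj : Injective _≡_ _≡_ h
      h-inj = proj₂ (proj₂ H)

    fixed : ∀ i → ∃ λ x → h (inj₁ i) ≡ inj₁ x
    fixed i = ι-fixed (h (inj₁ i)) (sym (h-ι (inj₁ i)))

    free : ∀ j → ∃ λ y → h (inj₂ (j , false)) ≡ inj₂ y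
    free j = ι-moved (h (inj₂ (j , false)))
      -- If the image were fixed, `h` would identify the two points of orbit `j`.
      λ eq → case h-inj (trans (h-ι (inj₂ (j , false))) eq) of λ ()

    -- By equivariance the value at `true` is the flip of the value at `false`, and `true xor s` is
    -- `not s`.
    free-sign : ∀ j b → h (inj₂ (j , b)) ≡
                inj₂ (proj₁ (proj₁ (free j)) , b xor proj₂ (proj₁ (free j)))
    free-sign j false = proj₂ (free j)
    free-sign j true  = trans (h-ι (inj₂ (j , false))) (cong ι (proj₂ (free j)))

    fixed-injective : Injective _≡_ _≡_ (proj₁ ∘ fixed)
    fixed-injective {i} {j} eq = inj₁-injective (h-inj
      (trans (proj₂ (fixed i)) (trans (cong inj₁ eq) (sym (proj₂ (fixed j))))))

    -- The points (i , si) and (j , sj) are chosen so that both images have sign false.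
    free-injective : Injective _≡_ _≡_ (proj₁ ∘ proj₁ ∘ free)
    free-injective {i} {j} eq = ,-injectiveˡ (inj₂-injective (h-inj
      (trans (free-sign i si) (trans (cong inj₂ (cong₂ _,_ eq
        (trans (xor-same si) (sym (xor-same sj))))) (sym (free-sign j sj))))))
      where
      si = proj₂ (proj₁ (free i))
      sj = proj₂ (proj₁ (free j))

  fixed-cong : ∀ h h′ → Setoid._≈_ S h h′ → ∀ i → proj₁ (fixed h i) ≡ proj₁ (fixed h′ i)
  fixed-cong h h′ eq i = inj₁-injective
    (trans (sym (proj₂ (fixed h i))) (trans (eq (inj₁ i)) (proj₂ (fixed h′ i))))

  free-cong : ∀ h h′ → Setoid._≈_ S h h′ → ∀ j → proj₁ (free h j) ≡ proj₁ (free h′ j)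
  free-cong h h′ eq j = inj₂-injective
    (trans (sym (proj₂ (free h j))) (trans (eq (inj₂ (j , false))) (proj₂ (free h′ j))))

  to : Setoid.Carrier S → Setoid.Carrier T
  to h = ((λ j → proj₂ (proj₁ (free h j))) , _ , fixed-injective h) , _ , free-injective h

  from : Setoid.Carrier T → Setoid.Carrier S
  from ((s , f , f-inj) , g , g-inj) = h , h-ι , h-inj
    where
    h : Orbits c a → Orbits n N
    h (inj₁ i)       = inj₁ (f i)
    h (inj₂ (j , b)) = inj₂ (g j , b xor s j)

    h-ι : ∀ i → h (ι i) ≡ ι (h i)
    h-ι (inj₁ i)       = refl
    h-ι (inj₂ (j , b)) = cong (λ b → inj₂ (g j , b)) (sym (not-distribˡ-xor b (s j)))

    xor-cancelʳ : ∀ b b′ t → b xor t ≡ b′ xor t → b ≡ b′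
    xor-cancelʳ b b′ t eq = trans (sym (undo b)) (trans (cong (_xor t) eq) (undo b′))
      where
      undo : ∀ b → (b xor t) xor t ≡ b
      undo b = trans (xor-assoc b t t) (trans (cong (b xor_) (xor-same t)) (xor-identityʳ b))

    h-inj : Injective _≡_ _≡_ h
    h-inj {inj₁ _} {inj₁ _} eq = cong inj₁ (f-inj (inj₁-injective eq))
    h-inj {inj₂ (i , b)} {inj₂ (j , b′)} eq
      with g-inj (,-injectiveˡ (inj₂-injective eq))
    ... | refl = cong (λ b → inj₂ (i , b))
                   (xor-cancelʳ b b′ (s i) (,-injectiveʳ (inj₂-injective eq)))

  to∘from : ∀ x → Setoid._≈_ T (to (from x)) x
  to∘from ((s , f , f-inj) , g , g-inj) = ((λ _ → refl) , (λ _ → refl)) , (λ _ → refl)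

  from∘to : ∀ h → Setoid._≈_ S (from (to h)) h
  from∘to h (inj₁ i)       = sym (proj₂ (fixed h i))
  from∘to h (inj₂ (j , b)) = sym (free-sign h j b)

-- The quotients with truncated subtraction agree with the falling factorials when c ≤ n and a ≤ N.
-- The given equivariant injection supplies both inequalities through its two components.
equivariantInjections-cardinality : ∀ c a n N →
  Setoid.Carrier (EquivariantInjections c a n N) →
  HasCardinality (EquivariantInjections c a n N)
    (2 ^ a * (n ! / (n ∸ c) !) {{(n ∸ c) !≢0}} * (N ! / (N ∸ a) !) {{(N ∸ a) !≢0}})
equivariantInjections-cardinality c a n N h =
  subst₂ (λ p q → HasCardinality (EquivariantInjections c a n N) (2 ^ a * p * q))
    (nP′k≡n!/[n∸k]! (injective⇒≤ f-inj)) (nP′k≡n!/[n∸k]! (injective⇒≤ g-inj))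
    (compose split (×-cardinality
      (×-cardinality (signs-cardinality a) (injections-cardinality c n))
      (injections-cardinality a N)))
  where
  split = equivariantInjections-split c a n N
  f-inj = λ {x} {y} → proj₂ (proj₂ (proj₁ (Inverse.to split h))) {x} {y}
  g-inj = λ {x} {y} → proj₂ (proj₂ (Inverse.to split h)) {x} {y}

-- The square of a finite set as an involutive set.

-- The binomial coefficient `n C 2` in the form that `encode` recurses on: n edges at the new vertex
-- `zero`, then the edges among the old vertices.
triangle : ℕ → ℕ
triangle zero    = 0
triangle (suc n) = n + triangle n

triangle≡nC2 : ∀ n → triangle n ≡ n C 2
triangle≡nC2 zero    = refl
triangle≡nC2 (suc n) = begin
  n + triangle n   ≡⟨ cong₂ _+_ (sym (nC1≡n n)) (triangle≡nC2 n) ⟩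
  n C 1 + n C 2    ≡⟨ nCk+nC[k+1]≡[n+1]C[k+1] n 1 ⟩
  suc n C 2        ∎
  where open ≡-Reasoning

EquivariantBijection : Set ℓ → ℕ → ℕ → Set ℓ
EquivariantBijection X n N =
  Σ ((X × X) ↔ Orbits n N) λ φ → ∀ q → Inverse.to φ (swap q) ≡ ι (Inverse.to φ q)

-- Induction splitting off the vertex `zero`: its pairs with the n other vertices form the first n
-- free orbits, and the orbits of the smaller square are shifted past them. Sign `true` marks the
-- pairs with smaller first entry.
pairs↔orbits : ∀ n → EquivariantBijection (Fin n) n (triangle n)
pairs↔orbits n = mk↔ₛ′ (encode n) (decode n) (encode∘decode n) (decode∘encode n) , encode-swap n
  where
  raise : ∀ {n} → Orbits n (triangle n) → Orbits (suc n) (triangle (suc n))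
  raise {n} = Sum.map suc (map₁ (n ↑ʳ_))

  encode : ∀ n → Fin n × Fin n → Orbits n (triangle n)
  encode (suc n) (zero  , zero)  = inj₁ zero
  encode (suc n) (zero  , suc j) = inj₂ (j ↑ˡ triangle n , true)
  encode (suc n) (suc i , zero)  = inj₂ (i ↑ˡ triangle n , false)
  encode (suc n) (suc i , suc j) = raise (encode n (i , j))

  edge : ∀ {n} → Fin n → Bool → Fin (suc n) × Fin (suc n)
  edge j true  = zero , suc j
  edge j false = suc j , zero

  decode : ∀ n → Orbits n (triangle n) → Fin n × Fin n
  -- The result of `splitAt` is an argument here so that `cong` can rewrite it.
  decode-free : ∀ n → Fin n ⊎ Fin (triangle n) → Bool → Fin (suc n) × Fin (suc n)

  decode (suc n) (inj₁ zero)    = zero , zero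
  decode (suc n) (inj₁ (suc i)) = map suc suc (decode n (inj₁ i))
  decode (suc n) (inj₂ (k , b)) = decode-free n (splitAt n k) b

  decode-free n (inj₁ j) b = edge j b
  decode-free n (inj₂ k) b = map suc suc (decode n (inj₂ (k , b)))

  decode-raise : ∀ n x → decode (suc n) (raise x) ≡ map suc suc (decode n x)
  decode-raise n (inj₁ i)       = refl
  decode-raise n (inj₂ (k , b)) =
    cong (λ s → decode-free n s b) (splitAt-↑ʳ n (triangle n) k)

  decode∘encode : ∀ n p → decode n (encode n p) ≡ p
  decode∘encode (suc n) (zero  , zero)  = refl
  decode∘encode (suc n) (zero  , suc j) =
    cong (λ s → decode-free n s true) (splitAt-↑ˡ n j (triangle n))
  decode∘encode (suc n) (suc i , zero)  =
    cong (λ s → decode-free n s false) (splitAt-↑ˡ n i (triangle n))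
  decode∘encode (suc n) (suc i , suc j) =
    trans (decode-raise n (encode n (i , j))) (cong (map suc suc) (decode∘encode n (i , j)))

  encode∘decode : ∀ n x → encode n (decode n x) ≡ x
  encode∘decode (suc n) (inj₁ zero)    = refl
  encode∘decode (suc n) (inj₁ (suc i)) = cong raise (encode∘decode n (inj₁ i))
  encode∘decode (suc n) (inj₂ (k , b)) with splitAt n k in eq
  encode∘decode (suc n) (inj₂ (k , true))  | inj₁ j =
    cong (λ k → inj₂ (k , true)) (splitAt⁻¹-↑ˡ eq)
  encode∘decode (suc n) (inj₂ (k , false)) | inj₁ j =
    cong (λ k → inj₂ (k , false)) (splitAt⁻¹-↑ˡ eq)
  encode∘decode (suc n) (inj₂ (k , b))     | inj₂ l =
    trans (cong raise (encode∘decode n (inj₂ (l , b))))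
          (cong (λ k → inj₂ (k , b)) (splitAt⁻¹-↑ʳ {n} eq))

  raise-ι : ∀ {n} (x : Orbits n (triangle n)) → raise (ι x) ≡ ι (raise x)
  raise-ι (inj₁ _) = refl
  raise-ι (inj₂ _) = refl

  encode-swap : ∀ n q → encode n (swap q) ≡ ι (encode n q)
  encode-swap (suc n) (zero  , zero)  = refl
  encode-swap (suc n) (zero  , suc j) = refl
  encode-swap (suc n) (suc i , zero)  = refl
  encode-swap (suc n) (suc i , suc j) =
    trans (cong raise (encode-swap n (i , j))) (raise-ι (encode n (i , j)))

square-bijection : {X : Set ℓ} → X ↔ Fin n → EquivariantBijection X n (n C 2)
square-bijection {n = n} {X} X↔n = subst (EquivariantBijection X n) (triangle≡nC2 n)
  (compose square (proj₁ (pairs↔orbits n)) , λ (x , y) → proj₂ (pairs↔orbits n) (to x , to y))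
  where
  open Inverse X↔n
  square : (X × X) ↔ (Fin n × Fin n)
  square = mk↔ₛ′ (map to to) (map from from)
    (λ (i , j) → cong₂ _,_ (strictlyInverseˡ i) (strictlyInverseˡ j))
    (λ (x , y) → cong₂ _,_ (strictlyInverseʳ x) (strictlyInverseʳ y))

-- Finite search and extension of maps along injections.

anyOrbit? : {P : Pred (Orbits m k) ℓ} → Decidable P → Dec (∃ P)
anyOrbit? P? = map′
  (λ { (inj₁ (i , Pi)) → inj₁ i , Pi
     ; (inj₂ (inj₁ (j , Pj))) → inj₂ (j , true) , Pj
     ; (inj₂ (inj₂ (j , Pj))) → inj₂ (j , false) , Pj })
  (λ { (inj₁ i , Pi) → inj₁ (i , Pi)
     ; (inj₂ (j , true) , Pj) → inj₂ (inj₁ (j , Pj))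
     ; (inj₂ (j , false) , Pj) → inj₂ (inj₂ (j , Pj)) })
  (any? (λ i → P? (inj₁ i)) ⊎-dec
   (any? (λ j → P? (inj₂ (j , true))) ⊎-dec any? (λ j → P? (inj₂ (j , false)))))

-- Membership in the image of `g` is decidable by finite search, and injectivity of `g` makes the
-- value at the index found the prescribed one.
extend : {Y : Set ℓ} {Z : Set r} → DecidableEquality Y → (Y → Z) →
  (g : Orbits m k → Y) → Injective _≡_ _≡_ g → (f : Orbits m k → Z) →
  ∃ λ (s : Y → Z) → ∀ i → s (g i) ≡ f i
extend {Y = Y} {Z} _≟_ default g g-inj f = s , s-spec
  where
  s : Y → Z
  s y with anyOrbit? (λ i → g i ≟ y)
  ... | yes (i , _) = f i
  ... | no _        = default y

  s-spec : ∀ i → s (g i) ≡ f i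
  s-spec i with anyOrbit? (λ j → g j ≟ g i)
  ... | yes (j , eq) = cong f (g-inj eq)
  ... | no ∄j        = contradiction (i , refl) ∄j

-- Right ideals.

module _ (M : Monoid ℓ r) where
  open Monoid M renaming (refl to ≈-refl; sym to ≈-sym; trans to ≈-trans)
  open Green M

  -- This reduces an 𝓡-relation to two memberships: each element lies in the right ideal of the
  -- other.
  ∈rightIdeal⇒⊆ : ∀ {x y} → y ∈ rightIdeal x → rightIdeal y ⊆ rightIdeal x
  ∈rightIdeal⇒⊆ {x} (s , y≈xs) (s′ , z≈ys′) =
    s ∙ s′ , ≈-trans z≈ys′ (≈-trans (∙-congʳ y≈xs) (assoc x s s′))

  ∈rightIdeal-refl : ∀ x → x ∈ rightIdeal x
  ∈rightIdeal-refl x = ε , ≈-sym (identityʳ x)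

-- The image of T_∗ as an involutive set.

-- e enumerates im(T_∗) compatibly with the involutions.
record ImageOrbits {X : Set ℓ} (∗ : Op₂ X) (c a : ℕ) : Set ℓ where
  field
    e           : Orbits c a → X × X
    e-ι         : ∀ i → e (ι i) ≡ swap (e i)
    e-injective : Injective _≡_ _≡_ e
    κ           : X × X → Orbits c a
    T≗e∘κ       : ∀ p → pairmorph ∗ p ≡ e (κ p)
    u           : Orbits c a → X × X
    T∘u≗e       : ∀ i → pairmorph ∗ (u i) ≡ e i

  κ∘u : ∀ i → κ (u i) ≡ i
  κ∘u i = e-injective (trans (sym (T≗e∘κ (u i))) (T∘u≗e i))

  -- T_∗ commutes with `swap` by computation, and the injective equivariant `e` can be cancelled.
  κ-swap : ∀ p → κ (swap p) ≡ ι (κ p)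
  κ-swap p = e-injective (begin
    e (κ (swap p))        ≡⟨ T≗e∘κ (swap p) ⟨
    swap (pairmorph ∗ p)  ≡⟨ cong swap (T≗e∘κ p) ⟩
    swap (e (κ p))        ≡⟨ e-ι (κ p) ⟨
    e (ι (κ p))           ∎)
    where open ≡-Reasoning

module _ {X : Set ℓ} (_≟_ : DecidableEquality X) (t : Tournament X r) (∗ : Op₂ X) where
  open Tournament t

  ω-asym : ∀ {q} → q ∈ ω → ¬ swap q ∈ ω
  ω-asym q∈ω q′∈ω with exactlyOne (ω⊆∁Δ q∈ω)
  ... | inj₁ (_ , q′∉ω) = q′∉ω q′∈ω
  ... | inj₂ (q∉ω , _)  = q∉ω q∈ω

  private
    T : X × X → X × X
    T = pairmorph ∗

  accok-value : ∀ d → proj₁ (accok t ∗ d) ≡ T (proj₁ d) ⊎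
                      proj₁ (accok t ∗ d) ≡ T (swap (proj₁ d))
  accok-value (_ , Tp∉Δ , _) with exactlyOne Tp∉Δ
  ... | inj₁ _ = inj₁ refl
  ... | inj₂ _ = inj₂ refl

  -- The diagonal points of im(T_∗) are the fixed points. Each off-diagonal orbit in im(T_∗) has
  -- exactly one member in ω, and these members form the image of `accok`; sign `true` marks them.
  imageOrbits : HasCrank ∗ c → HasArank t ∗ a → ImageOrbits ∗ c a
  imageOrbits {c} {a} crank arank = record
    { e = e ; e-ι = e-ι ; e-injective = e-injective
    ; κ = proj₁ ∘ index ; T≗e∘κ = proj₂ ∘ index
    ; u = proj₁ ∘ preimage ; T∘u≗e = proj₂ ∘ preimage }
    where
    module C = Inverse crank
    module A = Inverse arank

    e : Orbits c a → X × X
    e (inj₁ i)           = proj₁ (C.from i)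
    e (inj₂ (j , true))  = proj₁ (A.from j)
    e (inj₂ (j , false)) = swap (proj₁ (A.from j))

    e-ι : ∀ i → e (ι i) ≡ swap (e i)
    e-ι (inj₁ i) with C.from i
    ... | (x , .x) , _ , refl = refl
    e-ι (inj₂ (j , true))  = refl
    e-ι (inj₂ (j , false)) = refl

    fixed∈Δ : ∀ i → e (inj₁ i) ∈ Δ
    fixed∈Δ i = proj₂ (proj₂ (C.from i))

    free∈ω : ∀ j → e (inj₂ (j , true)) ∈ ω
    free∈ω j = let d , eq = proj₂ (A.from j) in subst ω eq (proj₂ (accok t ∗ d))

    free∉Δ : ∀ jb → ¬ e (inj₂ jb) ∈ Δ
    free∉Δ (j , true)  = ω⊆∁Δ (free∈ω j)
    free∉Δ (j , false) = ω⊆∁Δ (free∈ω j) ∘ sym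

    C-injective : ∀ {i j} → proj₁ (C.from i) ≡ proj₁ (C.from j) → i ≡ j
    C-injective eq = trans (sym (C.strictlyInverseˡ _)) (C.inverseˡ eq)

    A-injective : ∀ {i j} → proj₁ (A.from i) ≡ proj₁ (A.from j) → i ≡ j
    A-injective eq = trans (sym (A.strictlyInverseˡ _)) (A.inverseˡ eq)

    e-injective : Injective _≡_ _≡_ e
    e-injective {inj₁ i}  {inj₁ j}  eq = cong inj₁ (C-injective eq)
    e-injective {inj₁ i}  {inj₂ jb} eq = contradiction (subst Δ eq (fixed∈Δ i)) (free∉Δ jb)
    e-injective {inj₂ ib} {inj₁ j}  eq = contradiction (subst Δ (sym eq) (fixed∈Δ j)) (free∉Δ ib)
    e-injective {inj₂ (i , true)}  {inj₂ (j , true)}  eq =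
      cong (λ j → inj₂ (j , true)) (A-injective eq)
    e-injective {inj₂ (i , false)} {inj₂ (j , false)} eq =
      cong (λ j → inj₂ (j , false)) (A-injective (cong swap eq))
    -- The equation would make a member of ω the swap of another member of ω.
    e-injective {inj₂ (i , true)}  {inj₂ (j , false)} eq =
      contradiction (subst ω eq (free∈ω i)) (ω-asym (free∈ω j))
    e-injective {inj₂ (i , false)} {inj₂ (j , true)}  eq =
      contradiction (subst ω (sym eq) (free∈ω j)) (ω-asym (free∈ω i))

    accok-index : ∀ d → ∃ λ j → proj₁ (accok t ∗ d) ≡ e (inj₂ (j , true))
    accok-index d = A.to y , sym (A.strictlyInverseʳ y)
      where y = _ , d , refl

    index-oriented : ∀ p → ¬ T p ∈ Δ → p ∈ ω → ∃ λ i → T p ≡ e i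
    index-oriented p Tp∉Δ p∈ω = let j , eq = accok-index d in
      case accok-value d of λ
        { (inj₁ eq′) → inj₂ (j , true)  , trans (sym eq′) eq
        ; (inj₂ eq′) → inj₂ (j , false) , cong swap (trans (sym eq′) eq) }
      where d = p , Tp∉Δ , p∈ω

    index : ∀ p → ∃ λ i → T p ≡ e i
    index p@(x , y) with ∗ x y ≟ ∗ y x
    ... | yes Tp∈Δ = inj₁ (C.to q) , sym (C.strictlyInverseʳ q)
      where q = T p , (p , refl) , Tp∈Δ
    -- T_∗ maps the diagonal into itself, so an off-diagonal value forces x ≠ y and the tournament
    -- orients the pair.
    ... | no Tp∉Δ with exactlyOne {x} {y} (λ { refl → Tp∉Δ refl })
    ...   | inj₁ (p∈ω , _) = index-oriented p Tp∉Δ p∈ω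
    ...   | inj₂ (_ , p′∈ω) =
      let i , eq = index-oriented (swap p) (Tp∉Δ ∘ sym) p′∈ω
      in ι i , trans (cong swap eq) (sym (e-ι i))

    preimage : ∀ i → ∃ λ p → T p ≡ e i
    preimage (inj₁ i) = proj₁ (proj₂ (C.from i))
    -- `accok` may take its value at the swapped argument, in which case the preimage is swapped
    -- too.
    preimage (inj₂ (j , true)) = let d , eq = proj₂ (A.from j) in
      case accok-value d of λ
        { (inj₁ eq′) → proj₁ d , trans (sym eq′) eq
        ; (inj₂ eq′) → swap (proj₁ d) , trans (sym eq′) eq }
    preimage (inj₂ (j , false)) = let p , eq = preimage (inj₂ (j , true)) in
      swap p , cong swap eq

-- The 𝓡-class as a set of equivariant injections.

module _ {X : Set ℓ} (_≟_ : DecidableEquality X) (bijection : EquivariantBijection X n N)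
         (∗ : Op₂ X) (image : ImageOrbits ∗ c a) where
  open ImageOrbits image
  open Green (𝓜 X)
  open ≡-Reasoning

  private
    φ-swap = proj₂ bijection
    module φ = Inverse (proj₁ bijection)
    H = EquivariantInjections c a n N

  φ⁻¹-ι : ∀ i → φ.from (ι i) ≡ swap (φ.from i)
  φ⁻¹-ι i = φ.inverseʳ (begin
    ι i                       ≡⟨ cong ι (φ.strictlyInverseˡ i) ⟨
    ι (φ.to (φ.from i))       ≡⟨ φ-swap (φ.from i) ⟨
    φ.to (swap (φ.from i))    ∎)

  φ-injective : Injective _≡_ _≡_ φ.to
  φ-injective eq = trans (sym (φ.strictlyInverseʳ _)) (φ.inverseʳ eq)

  φ⁻¹-injective : Injective _≡_ _≡_ φ.from
  φ⁻¹-injective eq = trans (sym (φ.strictlyInverseˡ _)) (φ.inverseˡ eq)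

  -- The inclusion of im(T_∗) into X × X in orbit coordinates; it witnesses c ≤ n and a ≤ N in the
  -- final count.
  image-injection : Setoid.Carrier H
  image-injection = φ.to ∘ e
                  , (λ i → trans (cong φ.to (e-ι i)) (φ-swap (e i)))
                  , (λ eq → e-injective (φ-injective eq))

  -- If `y` equals `x ▷ s`, then T_y = T_s ∘ T_x. Applied in both directions, this gives 𝓡-related
  -- operations the same kernel.
  kernel-⊆ : ∀ {x y : Op₂ X} → y ∈ rightIdeal x → ∀ {p q} →
             pairmorph x p ≡ pairmorph x q → pairmorph y p ≡ pairmorph y q
  kernel-⊆ {x} {y} (s , y≈xs) {p} {q} eq = begin
    pairmorph y p                ≡⟨ factor p ⟩
    pairmorph s (pairmorph x p)  ≡⟨ cong (pairmorph s) eq ⟩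
    pairmorph s (pairmorph x q)  ≡⟨ factor q ⟨
    pairmorph y q                ∎
    where
    factor : ∀ p → pairmorph y p ≡ pairmorph s (pairmorph x p)
    factor (v , w) = cong₂ _,_ (y≈xs v w) (y≈xs w v)

  -- The multiplier sends `g i` to the first component of `f i`, which is consistent because `g` is
  -- injective.
  factor⇒∈rightIdeal : ∀ {x y : Op₂ X} {g f : Orbits c a → X × X} → Injective _≡_ _≡_ g →
    (∀ p → pairmorph x p ≡ g (κ p)) → (∀ p → pairmorph y p ≡ f (κ p)) → y ∈ rightIdeal x
  factor⇒∈rightIdeal {x} {y} {g} {f} g-inj Tx≗gκ Ty≗fκ =
    -- The default `proj₁` makes the multiplier agree with `lz` off the image of `g`.
    let s , s∘g≗f = extend (≡-dec _≟_ _≟_) proj₁ g g-inj (proj₁ ∘ f) in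
    (λ v w → s (v , w)) , λ v w → begin
      y v w                  ≡⟨ cong proj₁ (Ty≗fκ (v , w)) ⟩
      proj₁ (f (κ (v , w)))  ≡⟨ s∘g≗f (κ (v , w)) ⟨
      s (g (κ (v , w)))      ≡⟨ cong s (Tx≗gκ (v , w)) ⟨
      s (x v w , x w v)      ∎

  -- An operation `x` in the class corresponds to the `h` with T_x = φ⁻¹ ∘ h ∘ κ. Since `u` is a
  -- section of `κ`, this `h` is φ ∘ T_x ∘ u.
  𝓡-class-injections : Inverse (𝓡-class ∗) H
  𝓡-class-injections = mkInverse (𝓡-class ∗) H to from
    (λ x≈y i → cong φ.to (cong₂ _,_ (x≈y _ _) (x≈y _ _)))
    (λ h≗h′ v w → cong (proj₁ ∘ φ.from) (h≗h′ (κ (v , w))))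
    (λ h i → begin
      φ.to (pairmorph (operation h) (u i))  ≡⟨ cong φ.to (operation-pairmorph h (u i)) ⟩
      φ.to (φ.from (proj₁ h (κ (u i))))     ≡⟨ φ.strictlyInverseˡ _ ⟩
      proj₁ h (κ (u i))                     ≡⟨ cong (proj₁ h) (κ∘u i) ⟩
      proj₁ h i                             ∎)
    (λ (x , x𝓡) v w → cong proj₁ (begin
      φ.from (φ.to (pairmorph x (u (κ (v , w)))))  ≡⟨ φ.strictlyInverseʳ _ ⟩
      pairmorph x (u (κ (v , w)))                  ≡⟨ pairmorph-cong x𝓡 (κ∘u (κ (v , w))) ⟩
      pairmorph x (v , w)                          ∎))
    where
    pairmorph-cong : ∀ {x} → ∗ 𝓡 x → ∀ {p q} → κ p ≡ κ q → pairmorph x p ≡ pairmorph x q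
    pairmorph-cong {x} (_ , x⊆∗) {p} {q} eq =
      kernel-⊆ (x⊆∗ (∈rightIdeal-refl (𝓜 X) x))
        (trans (T≗e∘κ p) (trans (cong e eq) (sym (T≗e∘κ q))))

    to : Setoid.Carrier (𝓡-class ∗) → Setoid.Carrier H
    to (x , x𝓡@(∗⊆x , _)) = φ.to ∘ pairmorph x ∘ u , equivariant , injective
      where
      equivariant : ∀ i → φ.to (pairmorph x (u (ι i))) ≡ ι (φ.to (pairmorph x (u i)))
      -- The section `u` may fail to commute with the involutions, but `u (ι i)` and `swap (u i)`
      -- have the same `κ`, hence the same image under T_x.
      equivariant i = begin
        φ.to (pairmorph x (u (ι i)))     ≡⟨ cong φ.to (pairmorph-cong x𝓡 (begin
          κ (u (ι i))     ≡⟨ κ∘u (ι i) ⟩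
          ι i             ≡⟨ cong ι (κ∘u i) ⟨
          ι (κ (u i))     ≡⟨ κ-swap (u i) ⟨
          κ (swap (u i))  ∎)) ⟩
        φ.to (swap (pairmorph x (u i)))  ≡⟨ φ-swap _ ⟩
        ι (φ.to (pairmorph x (u i)))     ∎

      injective : Injective _≡_ _≡_ (φ.to ∘ pairmorph x ∘ u)
      injective {i} {j} eq = e-injective (begin
        e i                 ≡⟨ T∘u≗e i ⟨
        -- `∗` lies in the right ideal of `x`, so T_∗ identifies whatever T_x does.
        pairmorph ∗ (u i)   ≡⟨ kernel-⊆ (∗⊆x (∈rightIdeal-refl (𝓜 X) ∗)) (φ-injective eq) ⟩
        pairmorph ∗ (u j)   ≡⟨ T∘u≗e j ⟩
        e j                 ∎)

    operation : Setoid.Carrier H → Op₂ X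
    operation (h , _) v w = proj₁ (φ.from (h (κ (v , w))))

    -- The operation records only first components; equivariance of `κ`, `h` and φ⁻¹ recovers the
    -- second.
    operation-pairmorph : ∀ h p → pairmorph (operation h) p ≡ φ.from (proj₁ h (κ p))
    operation-pairmorph (h , h-ι , _) p = cong (proj₁ (φ.from (h (κ p))) ,_) (cong proj₁ (begin
      φ.from (h (κ (swap p)))   ≡⟨ cong (φ.from ∘ h) (κ-swap p) ⟩
      φ.from (h (ι (κ p)))      ≡⟨ cong φ.from (h-ι (κ p)) ⟩
      φ.from (ι (h (κ p)))      ≡⟨ φ⁻¹-ι (h (κ p)) ⟩
      swap (φ.from (h (κ p)))   ∎))

    from : Setoid.Carrier H → Setoid.Carrier (𝓡-class ∗)
    from h = operation h
           -- Both pairmorphs are `κ` followed by an injection, so each operation is a right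
           -- multiple of the other.
           , ∈rightIdeal⇒⊆ (𝓜 X)
               (factor⇒∈rightIdeal {f = e} h⁻-injective (operation-pairmorph h) T≗e∘κ)
           , ∈rightIdeal⇒⊆ (𝓜 X)
               (factor⇒∈rightIdeal {f = φ.from ∘ proj₁ h} e-injective T≗e∘κ (operation-pairmorph h))
      where
      h⁻-injective : Injective _≡_ _≡_ (φ.from ∘ proj₁ h)
      h⁻-injective eq = proj₂ (proj₂ h) (φ⁻¹-injective eq)

proposition15 : ∀ {ℓ r} (X : Set ℓ) (n : ℕ) → X ↔ Fin n →
    (t : Tournament X r) (∗ : Op₂ X) (c a : ℕ) →
    HasCrank ∗ c → HasArank t ∗ a →
    let N = n C 2 in
    HasCardinality (Green.𝓡-class (𝓜 X) ∗)
    (2 ^ a * (n ! / (n ∸ c) !) {{(n ∸ c) !≢0}} * (N ! / (N ∸ a) !) {{(N ∸ a) !≢0}})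
proposition15 X n X↔n t ∗ c a crank arank =
  compose (𝓡-class-injections _≟_ bijection ∗ image)
    (equivariantInjections-cardinality c a n (n C 2) (image-injection _≟_ bijection ∗ image))
  where
  _≟_ : DecidableEquality X
  _≟_ = via-injection (Inverse⇒Injection X↔n) Fin._≟_
  bijection = square-bijection X↔n
  image     = imageOrbits _≟_ t ∗ crank arank
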